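{- Let $n,m$ be natural numbers and let $P(x_{1},\dots,x_{n})$ and $Q(y_{1},\dots,y_{m})$ be homogeneous polynomials with integer coefficients, with constant term $0$, whose variables are exactly $x_{1},\dots,x_{n}$ and exactly $y_{1},\dots,y_{m}$ respectively, and which are both partition regular on $\mathbb{N}$. Suppose moreover that $\{x_{1},\dots,x_{n}\}\cap\{y_{1},\dots,y_{m}\}=\emptyset$. Then the polynomial $P(x_{1},\dots,x_{n})+Q(y_{1},\dots,y_{m})$ (in the $n+m$ variables $x_{1},\dots,x_{n},y_{1},\dots,y_{m}$) is partition regular on $\mathbb{N}$.
   Context: Here $\mathbb{N}=\{1,2,3,\dots\}$. A polynomial $R(t_{1},\dots,t_{s})$ with integer coefficients is partition regular on $\mathbb{N}$ if, for every finite coloration $\mathbb{N}=A_{1}\cup\dots\cup A_{r}$ of $\mathbb{N}$, the equation $R(t_{1},\dots,t_{s})=0$ has a monochromatic solution, i.e. there are an index $j\leq r$ and elements $a_{1},\dots,a_{s}\in A_{j}$ (not required to be distinct) with $R(a_{1},\dots,a_{s})=0$. The polynomials $P$ and $Q$ are not assumed to have the same degree. -}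

module Defs where

open import Data.Fin.Base using (Fin)
open import Data.Integer.Base using (ℤ; +_; 0ℤ; 1ℤ; _+_; _*_; _^_)
open import Data.List.Base as List using (List; _++_)
open import Data.Nat.Base as ℕ using (ℕ; NonZero)
import Data.Nat.Properties as ℕ
open import Data.Product.Base using (Σ; ∃; ∃-syntax; _×_; _,_; proj₁; proj₂; map₂)
open import Data.Vec.Base as Vec using (Vec; replicate; lookup; zipWith)
open import Data.Vec.Properties using (≡-dec)
open import Data.Vec.Relation.Unary.All using (All)
open import Level using (0ℓ)
open import Relation.Binary.PropositionalEquality using (_≡_; _≢_)
open import Relation.Unary using (Pred; _∈_)

ℕ⁺ : Set
ℕ⁺ = Σ ℕ NonZero

-- Integer polynomials in s variables are finite sums of terms
-- c · t₁^α₁ ⋯ tₛ^αₛ, given as pairs (c , α).  Like terms need not be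
-- collected and coefficients may vanish, so every property of a polynomial
-- below is stated through its total coefficients `coeff`, not its list of
-- terms.

Exponent : ℕ → Set
Exponent s = Vec ℕ s

Poly : ℕ → Set
Poly s = List (ℤ × Exponent s)

sumℤ : List ℤ → ℤ
sumℤ = List.foldr _+_ 0ℤ

coeff : ∀ {s} → Poly s → Exponent s → ℤ
coeff R α =
  sumℤ (List.map proj₁ (List.filter (λ t → ≡-dec ℕ._≟_ (proj₂ t) α) R))

monomial : ∀ {s} → Exponent s → Vec ℤ s → ℤ
monomial α a = Vec.foldr′ _*_ 1ℤ (zipWith _^_ a α)

eval : ∀ {s} → Poly s → Vec ℤ s → ℤ
eval R a = sumℤ (List.map (λ (c , α) → c * monomial α a) R)

Homogeneous : ∀ {s} → Poly s → Set
Homogeneous R = ∃[ d ] (∀ α → coeff R α ≢ 0ℤ → Vec.sum α ≡ d)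

ZeroConstantTerm : ∀ {s} → Poly s → Set
ZeroConstantTerm {s} R = coeff R (replicate s 0) ≡ 0ℤ

-- The variables of R are exactly t₁, …, tₛ: each one occurs in a monomial
-- with nonzero coefficient.
UsesAllVariables : ∀ {s} → Poly s → Set
UsesAllVariables {s} R =
  (i : Fin s) → ∃[ α ] (coeff R α ≢ 0ℤ × lookup α i ≢ 0)

-- P(x₁,…,xₙ) + Q(y₁,…,yₘ) in the n + m distinct variables x₁,…,xₙ,y₁,…,yₘ.
_⊕_ : ∀ {n m} → Poly n → Poly m → Poly (n ℕ.+ m)
_⊕_ {n} {m} P Q =
  List.map (map₂ (λ α → α Vec.++ replicate m 0)) P
  ++ List.map (map₂ (λ β → replicate n 0 Vec.++ β)) Q

-- The colour classes are only required to cover ℕ⁺; they may overlap or be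
-- empty.
Covers : ∀ {r} → (Fin r → Pred ℕ⁺ 0ℓ) → Set
Covers A = ∀ k → ∃[ j ] k ∈ A j

toℤ : ℕ⁺ → ℤ
toℤ k = + proj₁ k

PartitionRegular : ∀ {s} → Poly s → Set₁
PartitionRegular {s} R =
  ∀ (r : ℕ) (A : Fin r → Pred ℕ⁺ 0ℓ) → Covers A →
  ∃[ j ] Σ (Vec ℕ⁺ s) λ a → All (A j) a × eval R (Vec.map toℤ a) ≡ 0ℤ

{-# OPTIONS --safe #-}

-- A solution of P, dilated by any positive integer, is again a solution, and
-- likewise for Q; so it suffices to find solutions a of P and b of Q such that
-- all products aᵢ · bₖ have one colour, and then to take b₁ · a and a₁ · b.
-- By compactness there is an N such that every r-colouring yields a
-- monochromatic solution of P with entries below N.  Given a colouring c, let b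
-- be a solution of Q that is monochromatic for x ↦ (c (x · i))_{i < N}, and a a
-- solution of P below N that is monochromatic for i ↦ c (b₁ · i).  Then
-- c (bₖ · aᵢ) = c (b₁ · aᵢ) depends on neither i nor k.
module Submission where

open import Defs
open import Axiom.ExcludedMiddle using (ExcludedMiddle)
open import Data.Nat.Base using (ℕ; NonZero; _+_)
open import Level using (0ℓ)

open import Data.Fin.Base using (Fin; zero; suc; toℕ; fromℕ<; funToFin; finToFun)
open import Data.Fin.Properties using (toℕ-fromℕ<; finToFun-funToFin)
open import Data.Integer.Base as ℤ using (ℤ; 0ℤ; 1ℤ)
import Data.Integer.Properties as ℤ
open import Data.Integer.Tactic.RingSolver using (solve-∀)
open import Data.List.Base as List using (List; []; _∷_; filter; length)
open import Data.List.Properties using (filter-reject; filter-notAll)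
open import Data.List.Relation.Unary.Any using (here)
open import Data.Nat.Base as ℕ using (zero; suc; _≤_; _<_; _⊔_)
import Data.Nat.Properties as ℕ
open import Data.Product.Base using (∃; ∃-syntax; _×_; _,_; proj₁; proj₂; map₂)
open import Data.Sum.Base using (inj₁; inj₂)
open import Data.Unit.Base using (⊤; tt)
open import Data.Vec.Base as Vec using (Vec; []; _∷_; replicate)
open import Data.Vec.Properties as Vec using (≡-dec)
open import Data.Vec.Relation.Unary.All as All using (All; []; _∷_)
import Data.Vec.Relation.Unary.All.Properties as All
open import Function.Base using (_∘_)
open import Relation.Binary.Definitions using (DecidableEquality)
open import Relation.Binary.PropositionalEquality
open import Relation.Nullary.Decidable using (yes; no; ¬?; decidable-stable)
open import Relation.Nullary.Negation using (¬_; contradiction)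

open ≡-Reasoning

private
  variable
    r s n m N : ℕ

_≟ᵉ_ : DecidableEquality (Exponent s)
_≟ᵉ_ = ≡-dec ℕ._≟_

-- Homogeneous polynomials

infixr 7 _·_

_·_ : ℕ⁺ → ℕ⁺ → ℕ⁺
(x , x≢0) · (y , y≢0) = x ℕ.* y , ℕ.m*n≢0 x y {{x≢0}} {{y≢0}}

*-interchange : ∀ a b c d → a ℤ.* b ℤ.* (c ℤ.* d) ≡ a ℤ.* c ℤ.* (b ℤ.* d)
*-interchange = solve-∀

^-distribʳ-* : ∀ i j d → (i ℤ.* j) ℤ.^ d ≡ i ℤ.^ d ℤ.* j ℤ.^ d
^-distribʳ-* i j zero    = refl
^-distribʳ-* i j (suc d) = begin
  i ℤ.* j ℤ.* (i ℤ.* j) ℤ.^ d            ≡⟨ cong (i ℤ.* j ℤ.*_) (^-distribʳ-* i j d) ⟩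
  i ℤ.* j ℤ.* (i ℤ.^ d ℤ.* j ℤ.^ d)      ≡⟨ *-interchange i j (i ℤ.^ d) (j ℤ.^ d) ⟩
  i ℤ.* i ℤ.^ d ℤ.* (j ℤ.* j ℤ.^ d)      ∎

monomial-dilate : ∀ (k : ℤ) (α : Exponent s) (x : Vec ℤ s) →
  monomial α (Vec.map (k ℤ.*_) x) ≡ k ℤ.^ Vec.sum α ℤ.* monomial α x
monomial-dilate k []      []      = refl
monomial-dilate k (d ∷ α) (x ∷ xs) = begin
  (k ℤ.* x) ℤ.^ d ℤ.* monomial α (Vec.map (k ℤ.*_) xs)
    ≡⟨ cong₂ ℤ._*_ (^-distribʳ-* k x d) (monomial-dilate k α xs) ⟩
  k ℤ.^ d ℤ.* x ℤ.^ d ℤ.* (k ℤ.^ Vec.sum α ℤ.* monomial α xs)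
    ≡⟨ *-interchange (k ℤ.^ d) (x ℤ.^ d) (k ℤ.^ Vec.sum α) (monomial α xs) ⟩
  k ℤ.^ d ℤ.* k ℤ.^ Vec.sum α ℤ.* (x ℤ.^ d ℤ.* monomial α xs)
    ≡⟨ cong (ℤ._* (x ℤ.^ d ℤ.* monomial α xs)) (ℤ.^-distribˡ-+-* k d (Vec.sum α)) ⟨
  k ℤ.^ (d + Vec.sum α) ℤ.* (x ℤ.^ d ℤ.* monomial α xs)
    ∎

coeff-∷-≢ : ∀ c {α β : Exponent s} R → β ≢ α → coeff ((c , β) ∷ R) α ≡ coeff R α
coeff-∷-≢ c {α} {β} R β≢α =
  cong (sumℤ ∘ List.map proj₁)
    (filter-reject (λ t → proj₂ t ≟ᵉ α) {x = c , β} {xs = R} β≢α)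

removeTerms : Exponent s → Poly s → Poly s
removeTerms α = filter (λ t → ¬? (proj₂ t ≟ᵉ α))

-- Collecting like terms for a single exponent brings the total coefficient into the evaluation.
eval-removeTerms : ∀ (α : Exponent s) R x →
  eval R x ≡ coeff R α ℤ.* monomial α x ℤ.+ eval (removeTerms α R) x
eval-removeTerms α []            x = refl
eval-removeTerms α ((c , β) ∷ R) x with β ≟ᵉ α
... | yes refl rewrite eval-removeTerms α R x =
  collect c (coeff R α) (monomial α x) (eval (removeTerms α R) x)
  where
  collect : ∀ a b μ e →
    a ℤ.* μ ℤ.+ (b ℤ.* μ ℤ.+ e) ≡ (a ℤ.+ b) ℤ.* μ ℤ.+ e
  collect = solve-∀
... | no _ rewrite eval-removeTerms α R x =
  swap (c ℤ.* monomial β x) (coeff R α ℤ.* monomial α x) (eval (removeTerms α R) x)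
  where
  swap : ∀ a b e → a ℤ.+ (b ℤ.+ e) ≡ b ℤ.+ (a ℤ.+ e)
  swap = solve-∀

coeff-removeTerms-≡ : ∀ (α : Exponent s) R → coeff (removeTerms α R) α ≡ 0ℤ
coeff-removeTerms-≡ α []            = refl
coeff-removeTerms-≡ α ((c , β) ∷ R) with β ≟ᵉ α
... | yes refl = coeff-removeTerms-≡ α R
... | no β≢α rewrite coeff-∷-≢ c (removeTerms α R) β≢α =
  coeff-removeTerms-≡ α R

coeff-removeTerms-≢ : ∀ {α β : Exponent s} R → α ≢ β →
  coeff (removeTerms α R) β ≡ coeff R β
coeff-removeTerms-≢                 []            α≢β = refl
coeff-removeTerms-≢ {α = α} {β = β} ((c , γ) ∷ R) α≢β with γ ≟ᵉ α
... | yes refl rewrite coeff-∷-≢ c R α≢β =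
  coeff-removeTerms-≢ R α≢β
... | no _ with γ ≟ᵉ β
...   | yes refl = cong (ℤ._+_ c) (coeff-removeTerms-≢ R α≢β)
...   | no _     = coeff-removeTerms-≢ R α≢β

HomogeneousOfDegree : ℕ → Poly s → Set
HomogeneousOfDegree d R = ∀ α → coeff R α ≢ 0ℤ → Vec.sum α ≡ d

-- The total coefficient at `α` becomes zero and all others are unchanged, so no new exponent has to
-- be checked.
removeTerms-homogeneous : ∀ {d} (α : Exponent s) R →
  HomogeneousOfDegree d R → HomogeneousOfDegree d (removeTerms α R)
removeTerms-homogeneous α R hom β coeff≢0 with α ≟ᵉ β
... | yes refl = contradiction (coeff-removeTerms-≡ α R) coeff≢0
... | no  α≢β  = hom β (coeff≢0 ∘ trans (coeff-removeTerms-≢ R α≢β))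

-- The induction is on a bound for the number of terms: all the terms with the
-- exponent of the first one are split off together, since only their total
-- coefficient is known to obey homogeneity.
eval-dilate-bounded : ∀ l {d} (R : Poly s) → length R ≤ l → HomogeneousOfDegree d R →
  ∀ k x → eval R (Vec.map (k ℤ.*_) x) ≡ k ℤ.^ d ℤ.* eval R x
eval-dilate-bounded l {d} [] _ _ k x = sym (ℤ.*-zeroʳ (k ℤ.^ d))
eval-dilate-bounded (suc l) {d} R@((c , α) ∷ _) |R|≤1+l hom k x = begin
  eval R kx
    ≡⟨ eval-removeTerms α R kx ⟩
  coeff R α ℤ.* monomial α kx ℤ.+ eval (removeTerms α R) kx
    ≡⟨ cong₂ ℤ._+_ leading
         (eval-dilate-bounded l (removeTerms α R) shorter
           (removeTerms-homogeneous α R hom) k x) ⟩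
  k ℤ.^ d ℤ.* (coeff R α ℤ.* monomial α x) ℤ.+ k ℤ.^ d ℤ.* eval (removeTerms α R) x
    ≡⟨ ℤ.*-distribˡ-+ (k ℤ.^ d) _ _ ⟨
  k ℤ.^ d ℤ.* (coeff R α ℤ.* monomial α x ℤ.+ eval (removeTerms α R) x)
    ≡⟨ cong (k ℤ.^ d ℤ.*_) (eval-removeTerms α R x) ⟨
  k ℤ.^ d ℤ.* eval R x
    ∎
  where
  kx = Vec.map (k ℤ.*_) x

  -- The first term has exponent `α`, so at least that one is dropped.
  shorter : length (removeTerms α R) ≤ l
  shorter = ℕ.s≤s⁻¹ (ℕ.≤-trans
    (filter-notAll (λ t → ¬? (proj₂ t ≟ᵉ α)) R (here λ α≢α → α≢α refl)) |R|≤1+l)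

  -- `hom` fixes the degree of `α` only if its total coefficient is nonzero; otherwise both sides
  -- vanish.
  leading : coeff R α ℤ.* monomial α kx ≡ k ℤ.^ d ℤ.* (coeff R α ℤ.* monomial α x)
  leading with coeff R α ℤ.≟ 0ℤ
  ... | yes coeff≡0 rewrite coeff≡0 = sym (ℤ.*-zeroʳ (k ℤ.^ d))
  ... | no  coeff≢0 rewrite monomial-dilate k α x | hom α coeff≢0 =
    rotate (coeff R α) (k ℤ.^ d) (monomial α x)
    where
    rotate : ∀ a b μ → a ℤ.* (b ℤ.* μ) ≡ b ℤ.* (a ℤ.* μ)
    rotate = solve-∀

IsRoot : Poly s → Vec ℕ⁺ s → Set
IsRoot R a = eval R (Vec.map toℤ a) ≡ 0ℤ

toℤ-· : ∀ x y → toℤ (x · y) ≡ toℤ x ℤ.* toℤ y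
toℤ-· (x , _) (y , _) = ℤ.pos-* x y

IsRoot-dilate : ∀ (R : Poly s) → Homogeneous R → ∀ k a →
  IsRoot R a → IsRoot R (Vec.map (k ·_) a)
IsRoot-dilate R (d , hom) k a root = begin
  eval R (Vec.map toℤ (Vec.map (k ·_) a))
    ≡⟨ cong (eval R) (Vec.map-∘ toℤ (k ·_) a) ⟨
  eval R (Vec.map (λ x → toℤ (k · x)) a)
    ≡⟨ cong (eval R) (Vec.map-cong (toℤ-· k) a) ⟩
  eval R (Vec.map (λ x → toℤ k ℤ.* toℤ x) a)
    ≡⟨ cong (eval R) (Vec.map-∘ (toℤ k ℤ.*_) toℤ a) ⟩
  eval R (Vec.map (toℤ k ℤ.*_) (Vec.map toℤ a))
    ≡⟨ eval-dilate-bounded (length R) R ℕ.≤-refl hom (toℤ k) (Vec.map toℤ a) ⟩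
  toℤ k ℤ.^ d ℤ.* eval R (Vec.map toℤ a)
    ≡⟨ cong (toℤ k ℤ.^ d ℤ.*_) root ⟩
  toℤ k ℤ.^ d ℤ.* 0ℤ
    ≡⟨ ℤ.*-zeroʳ (toℤ k ℤ.^ d) ⟩
  0ℤ
    ∎

-- Sums in disjoint variables

monomial-zero : ∀ (x : Vec ℤ s) → monomial (replicate s 0) x ≡ 1ℤ
monomial-zero []       = refl
monomial-zero (x ∷ xs) = trans (ℤ.*-identityˡ _) (monomial-zero xs)

monomial-++ : ∀ (α : Exponent n) (β : Exponent m) x y →
  monomial (α Vec.++ β) (x Vec.++ y) ≡ monomial α x ℤ.* monomial β y
monomial-++ []      β []       y = sym (ℤ.*-identityˡ _)
monomial-++ (d ∷ α) β (x ∷ xs) y =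
  trans (cong (x ℤ.^ d ℤ.*_) (monomial-++ α β xs y)) (sym (ℤ.*-assoc (x ℤ.^ d) _ _))

eval-++ : ∀ (R S : Poly s) x → eval (R List.++ S) x ≡ eval R x ℤ.+ eval S x
eval-++ []            S x = sym (ℤ.+-identityˡ _)
eval-++ ((c , α) ∷ R) S x =
  trans (cong (ℤ._+_ (c ℤ.* monomial α x)) (eval-++ R S x)) (sym (ℤ.+-assoc (c ℤ.* monomial α x) _ _))

eval-mapExponents : ∀ (f : Exponent n → Exponent m) x y →
  (∀ α → monomial (f α) y ≡ monomial α x) →
  ∀ R → eval (List.map (map₂ f) R) y ≡ eval R x
eval-mapExponents f x y eq []            = refl
eval-mapExponents f x y eq ((c , α) ∷ R) =
  cong₂ ℤ._+_ (cong (c ℤ.*_) (eq α)) (eval-mapExponents f x y eq R)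

-- The zero exponents used as padding contribute a factor 1 to every monomial.
eval-⊕ : ∀ (P : Poly n) (Q : Poly m) x y →
  eval (P ⊕ Q) (x Vec.++ y) ≡ eval P x ℤ.+ eval Q y
eval-⊕ {n} {m} P Q x y = begin
  eval (P ⊕ Q) (x Vec.++ y)
    ≡⟨ eval-++ (List.map (map₂ (Vec._++ replicate m 0)) P) _ (x Vec.++ y) ⟩
  eval (List.map (map₂ (Vec._++ replicate m 0)) P) (x Vec.++ y) ℤ.+
  eval (List.map (map₂ (replicate n 0 Vec.++_)) Q) (x Vec.++ y)
    ≡⟨ cong₂ ℤ._+_
         (eval-mapExponents (Vec._++ replicate m 0) x (x Vec.++ y) left P)
         (eval-mapExponents (replicate n 0 Vec.++_) y (x Vec.++ y) right Q) ⟩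
  eval P x ℤ.+ eval Q y
    ∎
  where
  left : ∀ α → monomial (α Vec.++ replicate m 0) (x Vec.++ y) ≡ monomial α x
  left α = begin
    monomial (α Vec.++ replicate m 0) (x Vec.++ y) ≡⟨ monomial-++ α _ x y ⟩
    monomial α x ℤ.* monomial (replicate m 0) y    ≡⟨ cong (monomial α x ℤ.*_) (monomial-zero y) ⟩
    monomial α x ℤ.* 1ℤ                            ≡⟨ ℤ.*-identityʳ _ ⟩
    monomial α x                                   ∎
  right : ∀ β → monomial (replicate n 0 Vec.++ β) (x Vec.++ y) ≡ monomial β y
  right β = begin
    monomial (replicate n 0 Vec.++ β) (x Vec.++ y) ≡⟨ monomial-++ (replicate n 0) β x y ⟩
    monomial (replicate n 0) x ℤ.* monomial β y    ≡⟨ cong (ℤ._* monomial β y) (monomial-zero x) ⟩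
    1ℤ ℤ.* monomial β y                            ≡⟨ ℤ.*-identityˡ _ ⟩
    monomial β y                                   ∎

IsRoot-⊕ : ∀ (P : Poly n) (Q : Poly m) a b →
  IsRoot P a → IsRoot Q b → IsRoot (P ⊕ Q) (a Vec.++ b)
IsRoot-⊕ P Q a b rootP rootQ = begin
  eval (P ⊕ Q) (Vec.map toℤ (a Vec.++ b))            ≡⟨ cong (eval (P ⊕ Q)) (Vec.map-++ toℤ a b) ⟩
  eval (P ⊕ Q) (Vec.map toℤ a Vec.++ Vec.map toℤ b)  ≡⟨ eval-⊕ P Q (Vec.map toℤ a) (Vec.map toℤ b) ⟩
  eval P (Vec.map toℤ a) ℤ.+ eval Q (Vec.map toℤ b)  ≡⟨ cong₂ ℤ._+_ rootP rootQ ⟩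
  0ℤ                                                 ∎

-- Compactness

-- Colourings are extended to 0, where their value plays no role.
Colouring : ℕ → Set
Colouring r = ℕ → Fin r

MonochromaticRoot : Poly s → Colouring r → Set
MonochromaticRoot R c =
  ∃[ j ] ∃[ a ] (All (λ x → c (proj₁ x) ≡ j) a × IsRoot R a)

MonochromaticRootBelow : Poly s → Colouring r → ℕ → Set
MonochromaticRootBelow R c N =
  ∃[ j ] ∃[ a ] (All (λ x → c (proj₁ x) ≡ j) a × All (λ x → proj₁ x < N) a × IsRoot R a)

monochromaticRoot : (R : Poly s) → PartitionRegular R → (c : Colouring r) → MonochromaticRoot R c
monochromaticRoot R pr c = pr _ (λ j x → c (proj₁ x) ≡ j) (λ x → c (proj₁ x) , refl)

bounded : (a : Vec ℕ⁺ s) → ∃[ N ] All (λ x → proj₁ x < N) a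
bounded []       = 0 , []
bounded (x ∷ xs) =
  let N , xs<N = bounded xs in
  suc (proj₁ x) ⊔ N ,
  ℕ.m≤m⊔n _ N ∷ All.map (λ y<N → ℕ.≤-trans y<N (ℕ.m≤n⊔m _ N)) xs<N

module _ (em : ExcludedMiddle 0ℓ) where

  ¬∀⇒∃¬ : {A : Set} {B : A → Set} → ¬ (∀ x → B x) → ∃[ x ] ¬ B x
  ¬∀⇒∃¬ ¬∀ = decidable-stable em λ ¬∃ →
    ¬∀ λ x → decidable-stable em λ ¬Bx → ¬∃ (x , ¬Bx)

  -- Induction on the number of indices. If index `zero` fails at `N₀`, it fails at every larger
  -- number, so `h (N ⊔ N₀)` must supply another index, and `anti` brings the bound back down to
  -- `N`.
  pigeonhole : (B : Fin r → ℕ → Set) → (∀ j {M N} → M ≤ N → B j N → B j M) →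
    (∀ N → ∃[ j ] B j N) → ∃[ j ] (∀ N → B j N)
  pigeonhole {zero}  B anti h with () ← proj₁ (h 0)
  pigeonhole {suc r} B anti h with em {∀ N → B zero N}
  ... | yes all = zero , all
  ... | no ¬all =
    let j , all = pigeonhole (B ∘ suc) (anti ∘ suc) tail in suc j , all
    where
    N₀ = proj₁ (¬∀⇒∃¬ ¬all)

    tail : ∀ N → ∃[ j ] B (suc j) N
    tail N with h (N ⊔ N₀)
    ... | zero  , b = contradiction (anti zero (ℕ.m≤n⊔m N N₀) b) (proj₂ (¬∀⇒∃¬ ¬all))
    ... | suc j , b = j , anti (suc j) (ℕ.m≤m⊔n N N₀) b

  module _ (B : Colouring r → ℕ → Set) (anti : ∀ f {M N} → M ≤ N → B f N → B f M)
           (h : ∀ N → ∃[ f ] B f N) where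

    -- The counterpart of a vertex with infinitely many descendants in König's lemma.
    Unbounded : (Colouring r → Set) → Set
    Unbounded S = ∀ N → ∃[ f ] (S f × B f N)

    -- The value at `k` splits `S` into finitely many subclasses, to which `pigeonhole` applies.
    unbounded-colour : ∀ k {S} → Unbounded S →
      ∃[ j ] Unbounded (λ f → S f × f k ≡ j)
    unbounded-colour k unb = pigeonhole _
      (λ { j M≤N (f , Sf , b) → f , Sf , anti f M≤N b })
      (λ N → let f , Sf , b = unb N in f k , f , (Sf , refl) , b)

    -- König's lemma: the colourings that agree with `limit` below k.
    prefixClass : ℕ → ∃ Unbounded
    prefixClass zero    = (λ _ → ⊤) , λ N → let f , b = h N in f , tt , b
    prefixClass (suc k) = _ , proj₂ (unbounded-colour k (proj₂ (prefixClass k)))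

    limit : Colouring r
    limit k = proj₁ (unbounded-colour k (proj₂ (prefixClass k)))

    prefixClass-agrees : ∀ k {f} → proj₁ (prefixClass k) f → ∀ {i} → i < k → f i ≡ limit i
    prefixClass-agrees (suc k) (Sf , fk≡) i<1+k with ℕ.m<1+n⇒m<n∨m≡n i<1+k
    ... | inj₁ i<k  = prefixClass-agrees k Sf i<k
    ... | inj₂ refl = fk≡

    -- `B` is asserted of the approximants `f` and not of `g`, since it may depend on values of `f`
    -- at or beyond `N`.
    compactness : ∃[ g ] (∀ N → ∃[ f ] (B f N × (∀ {i} → i < N → f i ≡ g i)))
    compactness = limit , λ N →
      let f , Sf , b = proj₂ (prefixClass N) N in f , b , prefixClass-agrees N Sf

  -- If every `N` had a bad colouring, these would have a limit `g`. A monochromatic root for `g`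
  -- has bounded entries, and a bad colouring that agrees with `g` below the bound would have the
  -- same root.
  monochromaticRootBelow : (R : Poly s) → PartitionRegular R → ∀ r →
    ∃[ N ] ((c : Colouring r) → MonochromaticRootBelow R c N)
  monochromaticRootBelow R pr r = decidable-stable em λ ¬∃ →
    let
      g , approx = compactness (λ f N → ¬ MonochromaticRootBelow R f N)
        (λ { f M≤N ¬N (j , a , mono , a<M , root) →
             ¬N (j , a , mono , All.map (λ x<M → ℕ.≤-trans x<M M≤N) a<M , root) })
        (λ N → ¬∀⇒∃¬ λ all → ¬∃ (N , all))
      j , a , mono , root = monochromaticRoot R pr g
      N , a<N = bounded a
      f , ¬N , f≡g = approx N
    in ¬N (j , a ,
           All.map (λ (gx≡j , x<N) → trans (f≡g x<N) gx≡j) (All.zip (mono , a<N)) ,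
           a<N , root)

-- Product colourings

-- Classes may overlap, so `cover` chooses the colour. The number 0 borrows the colour of 1, which
-- also shows that `Fin r` is inhabited.
colouring : {A : Fin r → ℕ⁺ → Set} → Covers A → Colouring r
colouring cover zero    = proj₁ (cover (1 , _))
colouring cover (suc k) = proj₁ (cover (suc k , _))

colouring-sound : {A : Fin r → ℕ⁺ → Set} (cover : Covers A) → ∀ {j} x →
  colouring cover (proj₁ x) ≡ j → A j x
colouring-sound cover (suc k , _) refl = proj₂ (cover (suc k , _))

-- Having at least one variable ensures that each root has an entry to serve as dilation factor for
-- the other.
head∈ : {B : ℕ⁺ → Set} → .{{_ : NonZero s}} → {a : Vec ℕ⁺ s} → All B a → ∃ B
head∈ (Bx ∷ _) = _ , Bx

-- The tuple of colours of `x ℕ.* i` for `i < N`, coded as one element of a finite set so that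
-- partition regularity applies to it.
productColouring : Colouring r → ∀ N → Colouring (r ℕ.^ N)
productColouring c N x = funToFin {N} (λ i → c (x ℕ.* toℕ i))

-- The right-hand side does not mention `x`: numbers with equal product colour have equally coloured
-- multiples by each `i < N`.
productColouring-≡ : ∀ (c : Colouring r) x {i j} → productColouring c N x ≡ j →
  (i<N : i < N) → c (x ℕ.* i) ≡ finToFun j (fromℕ< i<N)
productColouring-≡ {N = N} c x {i} {j} eq i<N = begin
  c (x ℕ.* i)                                       ≡⟨ cong (c ∘ (x ℕ.*_)) (toℕ-fromℕ< i<N) ⟨
  c (x ℕ.* toℕ (fromℕ< i<N))                        ≡⟨ finToFun-funToFin {N} (λ i → c (x ℕ.* toℕ i)) (fromℕ< i<N) ⟨
  finToFun (productColouring c N x) (fromℕ< i<N)    ≡⟨ cong (λ j → finToFun j (fromℕ< i<N)) eq ⟩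
  finToFun j (fromℕ< i<N)                           ∎

theorem3p9 : ExcludedMiddle 0ℓ →
    (n m : ℕ) .{{_ : NonZero n}} .{{_ : NonZero m}}
    (P : Poly n) (Q : Poly m) →
    Homogeneous P → Homogeneous Q →
    ZeroConstantTerm P → ZeroConstantTerm Q →
    UsesAllVariables P → UsesAllVariables Q →
    PartitionRegular P → PartitionRegular Q →
    PartitionRegular (P ⊕ Q)
theorem3p9 em n m P Q homP homQ _ _ _ _ prP prQ r A cover =
  let
    c = colouring cover
    -- `N` depends on `r` alone, so it is available before `b₁`, and hence the colouring for `P`, is
    -- chosen.
    N , rootBelow = monochromaticRootBelow em P prP r
    v , b , b-mono , rootQ = monochromaticRoot Q prQ (productColouring c N)
    b₁ , b₁-colour = head∈ b-mono
    j , a , a-mono , a<N , rootP = rootBelow (λ i → c (proj₁ b₁ ℕ.* i))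
    a₁ , b₁a₁-colour , a₁<N = head∈ (All.zip (a-mono , a<N))
    -- The product of `a₁` and `b₁` lies in both dilated roots and links their colours; `a₁<N`
    -- allows its coordinate to be read off the product colour.
    colour-a₁ : ∀ {y} → productColouring c N (proj₁ y) ≡ v → c (proj₁ a₁ ℕ.* proj₁ y) ≡ j
    colour-a₁ = λ {y} y-colour → begin
      c (proj₁ a₁ ℕ.* proj₁ y)   ≡⟨ cong c (ℕ.*-comm (proj₁ a₁) (proj₁ y)) ⟩
      c (proj₁ y ℕ.* proj₁ a₁)   ≡⟨ productColouring-≡ c (proj₁ y) y-colour a₁<N ⟩
      finToFun v (fromℕ< a₁<N)   ≡⟨ productColouring-≡ c (proj₁ b₁) b₁-colour a₁<N ⟨
      c (proj₁ b₁ ℕ.* proj₁ a₁)  ≡⟨ b₁a₁-colour ⟩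
      j                          ∎
  in
  j , Vec.map (b₁ ·_) a Vec.++ Vec.map (a₁ ·_) b ,
  All.++⁺
    (All.map⁺ (All.map (λ {x} → colouring-sound cover (b₁ · x)) a-mono))
    (All.map⁺ (All.map (λ {y} → colouring-sound cover (a₁ · y) ∘ colour-a₁ {y}) b-mono)) ,
  IsRoot-⊕ P Q (Vec.map (b₁ ·_) a) (Vec.map (a₁ ·_) b)
    (IsRoot-dilate P homP b₁ a rootP) (IsRoot-dilate Q homQ a₁ b rootQ)
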